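{- For every function $f_1$ there exists a function $f_2$ with $f_2\geq f_1$ such that the following holds. Let $G$ be a graph of pathwidth $\mathrm{pw}$ and maximum degree $\Delta$, and suppose the fire initially breaks out at a set $F$ of vertices with $|F|\le f_1(\mathrm{pw},\Delta)$, with at least one firefighter available at each step. Then there exists a protection strategy such that at most $f_2(\mathrm{pw},\Delta)$ vertices of $G$ are burned.
   Context: Firefighting process with a set $F$ of initially burned vertices: at step $0$ all vertices of $F$ are burned. At each step $t>0$: first some vertices not yet on fire are protected (at least one, at most the budget $b\ge 1$), then every unprotected vertex adjacent to a burned vertex becomes burned. Burned and protected vertices stay so; the process stops when no new vertex can be burned. A protection strategy specifies which vertices to protect at each step. Pathwidth is the minimum width (maximum bag size minus one) of a path decomposition of the graph. -}

module Defs where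

open import Data.Nat using (ℕ; zero; suc; _≤_; _<_)
open import Data.Bool using (Bool; true; false; _∧_)
open import Data.Fin using (Fin)
open import Data.Fin.Subset using (Subset; ⊥; ∁; _∩_; _∪_; _∈_; ∣_∣; Empty)
open import Data.List using (allFin)
open import Data.Bool.ListAction using (any)
open import Data.Vec using (tabulate)
open import Data.Vec.Functional using () renaming (Vector to FunVec)
open import Data.Product using (Σ; ∃; _×_)
open import Data.Sum using (_⊎_)
open import Relation.Nullary using (¬_)
open import Relation.Binary.PropositionalEquality using (_≡_)
import Data.Vec as V

record Graph : Set where
  field
    n     : ℕ
    adj   : Fin n → Fin n → Bool
    sym   : ∀ u v → adj u v ≡ adj v u
    irref : ∀ v → adj v v ≡ false
open Graph public

Adj : (G : Graph) → Fin (n G) → Fin (n G) → Set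
Adj G u v = adj G u v ≡ true

degree : (G : Graph) → Fin (n G) → ℕ
degree G v = ∣ tabulate (adj G v) ∣

-- Δ is the maximum degree of G (0 for the empty graph)
MaxDegree : Graph → ℕ → Set
MaxDegree G Δ = (∀ v → degree G v ≤ Δ) × (Δ ≡ 0 ⊎ ∃ λ v → degree G v ≡ Δ)

-- A path decomposition of G with m ≥ 1 bags, each of size at most s
-- (i.e. of width at most s - 1).
record PathDecomposition (G : Graph) (s : ℕ) : Set where
  field
    m          : ℕ
    bag        : Fin (suc m) → Subset (n G)
    bagSize    : ∀ i → ∣ bag i ∣ ≤ s
    covVertex  : ∀ v → ∃ λ i → v ∈ bag i
    covEdge    : ∀ u v → Adj G u v → ∃ λ i → (u ∈ bag i × v ∈ bag i)
    contiguous : ∀ (i j k : Fin (suc m)) v →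
                 Data.Fin.toℕ i ≤ Data.Fin.toℕ j → Data.Fin.toℕ j ≤ Data.Fin.toℕ k →
                 v ∈ bag i → v ∈ bag k → v ∈ bag j

Pathwidth : Graph → ℕ → Set
Pathwidth G pw =
  PathDecomposition G (suc pw) × (∀ k → k < pw → ¬ PathDecomposition G (suc k))

spread : (G : Graph) → Subset (n G) → Subset (n G)
spread G B = tabulate λ v → any (λ u → adj G u v ∧ V.lookup B u) (allFin (n G))

-- A strategy: P t is the set of vertices protected at step t+1.
Strategy : Graph → Set
Strategy G = ℕ → Subset (n G)

protected : (G : Graph) → Strategy G → ℕ → Subset (n G)
protected G P zero    = ⊥
protected G P (suc t) = protected G P t ∪ P t

burned : (G : Graph) → Subset (n G) → Strategy G → ℕ → Subset (n G)
burned G F P zero    = F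
burned G F P (suc t) =
  burned G F P t ∪ (spread G (burned G F P t) ∩ ∁ (protected G P (suc t)))

ValidStrategy : (G : Graph) → Subset (n G) → ℕ → Strategy G → Set
ValidStrategy G F b P = ∀ t →
  (∣ P t ∣ ≤ b) ×
  Empty (P t ∩ burned G F P t) ×
  (1 ≤ ∣ P t ∩ ∁ (protected G P t) ∣ ⊎
   Empty (∁ (burned G F P t ∪ protected G P t)))

{-# OPTIONS --safe #-}
-- Write N(r) for the ball of radius r about F, and s = pw + 1. Choose radii D(0) = 0 ≤ D(1) ≤ … ≤ D(s).
-- For each j < s and each vertex u of N(D(j) + 1), look from a bag of u in both directions for the
-- nearest bag missing the annulus N(D(j+1)) ∖ N(D(j)); protect those vertices of the two bags that lie
-- outside N(D(j+1)). At most 2 s |N(D(j) + 1)| vertices are added, so with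
-- D(j+1) = D(j) + 2 s |N(D(j) + 1)| (bounding ball sizes through Δ) all of them are protected in time.
-- A fire leaving N(D(j)) is then confined to bags meeting the j-th annulus. If a vertex outside N(D(s))
-- burned, its bag would meet all s annuli and so contain s + 1 vertices.
module Submission where

open import Defs hiding (sym)
open import Data.Nat using (ℕ; zero; suc; _+_; _*_; _≤_; _<_; _⊓_; _≤′_; ≤′-refl; ≤′-step; z≤n; s≤s)
open import Data.Nat.Properties using
  ( ≤-refl; ≤-trans; ≤-reflexive; ≤-total; ≤-antisym; ≤⇒≤′; n≤1+n; m≤m+n; m≤n⇒m<n∨m≡n; <⇒≱
  ; +-identityʳ; +-suc; +-comm; +-mono-≤; +-monoʳ-≤; *-monoˡ-≤
  ; m⊓n≤m; m≥n⇒m⊓n≡n; ⊓-monoʳ-≤; module ≤-Reasoning)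
open import Data.Bool using (Bool; true; false; _∧_)
open import Data.Bool.Properties using (T-≡)
open import Data.Empty using (⊥-elim)
open import Data.Fin using (Fin; zero; suc; toℕ; fromℕ<)
open import Data.Fin.Properties using
  (_≟_; suc-injective; injective⇒≤; toℕ-fromℕ<; toℕ≤pred[n]; toℕ-injective)
open import Data.Fin.Subset using (Subset; ∣_∣; _∈_; _∉_; _∩_; _∪_; ∁; ⁅_⁆; ⊥; Empty)
open import Data.Fin.Subset.Properties using
  ( _∈?_; ∉⊥; ∣⊥∣≡0; ∣⁅x⁆∣≡1; x∈⁅x⁆; x∈⁅y⁆⇒x≡y; x∈p∩q⁺; x∈p∩q⁻; x∈p∪q⁺; x∈p∪q⁻
  ; x∈∁p⇒x∉p; x∉p⇒x∈∁p; x∈p⇒∣p-x∣<∣p∣)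
open import Data.List using (List; []; _∷_; _++_; length; map; concatMap; filter; drop; allFin; lookup)
open import Data.List.Properties using (length-++; length-map; length-filter)
open import Data.List.Membership.Propositional using (find) renaming (_∈_ to _∈ₗ_; _∉_ to _∉ₗ_)
open import Data.List.Membership.Propositional.Properties using
  ( ∈-map⁺; ∈-map⁻; ∈-++⁺ˡ; ∈-++⁺ʳ; ∈-concatMap⁺; ∈-filter⁺; ∈-filter⁻; ∈-allFin; ∈-lookup)
open import Data.List.Relation.Unary.All as All using (All; []; _∷_)
open import Data.List.Relation.Unary.AllPairs using ([]; _∷_)
open import Data.List.Relation.Unary.Any as Any using (Any; here; there; any?; index)
open import Data.List.Relation.Unary.Any.Properties using (any⁻; lookup-index)
open import Data.List.Relation.Unary.Unique.Propositional using (Unique)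
import Data.List.Relation.Unary.Unique.Propositional.Properties as Unique
open import Data.Product using (Σ; ∃; _×_; _,_; proj₁; proj₂)
open import Data.Sum using (_⊎_; inj₁; inj₂; [_,_]′)
open import Data.Vec using (tabulate; []; _∷_)
import Data.Vec as V
open import Data.Vec.Properties using (lookup∘tabulate; []=⇒lookup; lookup⇒[]=)
open import Function using (_∘_; Equivalence)
open import Relation.Binary.PropositionalEquality using (_≡_; refl; sym; trans; cong; cong₂; subst)
open import Relation.Nullary using (¬_; yes; no; ¬?; _×-dec_; contradiction)
open import Relation.Unary using (Decidable)

private
  variable
    k : ℕ
    A : Set

-- Counting with duplicate-free lists and subsets

lookup-unique-injective : {xs : List A} → Unique xs → ∀ {i j} → lookup xs i ≡ lookup xs j → i ≡ j
lookup-unique-injective (_ ∷ _)   {zero}  {zero}  _  = refl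
lookup-unique-injective (x∉ ∷ _)  {zero}  {suc j} eq = contradiction eq (All.lookup x∉ (∈-lookup j))
lookup-unique-injective (x∉ ∷ _)  {suc i} {zero}  eq = contradiction (sym eq) (All.lookup x∉ (∈-lookup i))
lookup-unique-injective (_ ∷ xs!) {suc i} {suc j} eq = cong suc (lookup-unique-injective xs! eq)

-- Pigeonhole: distinct indices of `xs` carry distinct entries, so sending an index to the position
-- of its entry in `ys` is an injection between finite types.
unique⇒length≤ : {xs ys : List A} → Unique xs → (∀ {x} → x ∈ₗ xs → x ∈ₗ ys) → length xs ≤ length ys
unique⇒length≤ {xs = xs} {ys} xs! xs⊆ys = injective⇒≤ {f = position} λ {i} {j} eq →
  lookup-unique-injective xs! (trans (at i) (trans (cong (lookup ys) eq) (sym (at j))))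
  where
  position : Fin (length xs) → Fin (length ys)
  position i = index (xs⊆ys (∈-lookup i))
  at : ∀ i → lookup xs i ≡ lookup ys (position i)
  at i = lookup-index (xs⊆ys (∈-lookup i))

length-concatMap-≤ : {B : Set} (f : A → List B) → (∀ x → length (f x) ≤ k) →
                     ∀ xs → length (concatMap f xs) ≤ length xs * k
length-concatMap-≤ f f≤ []       = z≤n
length-concatMap-≤ f f≤ (x ∷ xs) = begin
  length (f x ++ concatMap f xs)        ≡⟨ length-++ (f x) ⟩
  length (f x) + length (concatMap f xs) ≤⟨ +-mono-≤ (f≤ x) (length-concatMap-≤ f f≤ xs) ⟩
  _                                     ∎
  where open ≤-Reasoning

elements : Subset k → List (Fin k)
elements []          = []
elements (true  ∷ p) = zero ∷ map suc (elements p)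
elements (false ∷ p) = map suc (elements p)

length-elements : (p : Subset k) → length (elements p) ≡ ∣ p ∣
length-elements []          = refl
length-elements (true  ∷ p) = cong suc (trans (length-map suc (elements p)) (length-elements p))
length-elements (false ∷ p) = trans (length-map suc (elements p)) (length-elements p)

∈-elements⁺ : {p : Subset k} {x : Fin k} → x ∈ p → x ∈ₗ elements p
∈-elements⁺ {p = true  ∷ p} V.here        = here refl
∈-elements⁺ {p = true  ∷ p} (V.there x∈p) = there (∈-map⁺ suc (∈-elements⁺ x∈p))
∈-elements⁺ {p = false ∷ p} (V.there x∈p) = ∈-map⁺ suc (∈-elements⁺ x∈p)

∈-elements⁻ : {p : Subset k} {x : Fin k} → x ∈ₗ elements p → x ∈ p
∈-elements⁻ {p = true  ∷ p} (here refl) = V.here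
∈-elements⁻ {p = true  ∷ p} (there x∈) with ∈-map⁻ suc x∈
... | _ , y∈ , refl = V.there (∈-elements⁻ y∈)
∈-elements⁻ {p = false ∷ p} x∈ with ∈-map⁻ suc x∈
... | _ , y∈ , refl = V.there (∈-elements⁻ y∈)

elements-unique : (p : Subset k) → Unique (elements p)
elements-unique []          = []
elements-unique (true  ∷ p) = All.tabulate zero∉ ∷ Unique.map⁺ suc-injective (elements-unique p)
  where
  zero∉ : ∀ {x} → x ∈ₗ map suc (elements p) → ¬ zero ≡ x
  zero∉ x∈ refl with ∈-map⁻ suc x∈
  ... | _ , _ , ()
elements-unique (false ∷ p) = Unique.map⁺ suc-injective (elements-unique p)

⊆⇒∣p∣≤length : (p : Subset k) (xs : List (Fin k)) → (∀ {x} → x ∈ p → x ∈ₗ xs) → ∣ p ∣ ≤ length xs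
⊆⇒∣p∣≤length p xs p⊆xs =
  subst (_≤ length xs) (length-elements p) (unique⇒length≤ (elements-unique p) (p⊆xs ∘ ∈-elements⁻))

∈⇒∣p∣>0 : {p : Subset k} {x : Fin k} → x ∈ p → 1 ≤ ∣ p ∣
∈⇒∣p∣>0 x∈p = ≤-trans (s≤s z≤n) (x∈p⇒∣p-x∣<∣p∣ x∈p)

-- Unoriented intervals and nearest failures of a predicate

Between : ℕ → ℕ → ℕ → Set
Between a b c = (a ≤ b × b ≤ c) ⊎ (c ≤ b × b ≤ a)

between-refl : ∀ {a b} → Between a b a → b ≡ a
between-refl (inj₁ (a≤b , b≤a)) = ≤-antisym b≤a a≤b
between-refl (inj₂ (a≤b , b≤a)) = ≤-antisym b≤a a≤b

between-split : ∀ {a b c} → Between a b c → ∀ e → Between a b e ⊎ Between e b c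
between-split {b = b} (inj₁ (a≤b , b≤c)) e with ≤-total b e
... | inj₁ b≤e = inj₁ (inj₁ (a≤b , b≤e))
... | inj₂ e≤b = inj₂ (inj₁ (e≤b , b≤c))
between-split {b = b} (inj₂ (c≤b , b≤a)) e with ≤-total b e
... | inj₁ b≤e = inj₂ (inj₂ (c≤b , b≤e))
... | inj₂ e≤b = inj₁ (inj₂ (e≤b , b≤a))

module _ {P : ℕ → Set} (P? : Decidable P) where

  Clear : ℕ → ℕ → Set
  Clear a c = ∀ b → Between a b c → P b

  -- The witness `z` is fixed before the target `c`, so one barrier serves every target. There may
  -- be no failure above `a`, so the search is bounded by `K`.
  firstFailureAbove : ∀ K a → ∃ λ z → ∀ c → a ≤ c → c < a + K →
    (∀ b → a ≤ b → b ≤ c → P b) ⊎ (¬ P z × a ≤ z × z ≤ c)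
  -- The value `a` is a placeholder: the range of targets is empty.
  firstFailureAbove zero a = a , λ c a≤c c<a →
    contradiction a≤c (<⇒≱ (subst (c <_) (+-identityʳ a) c<a))
  firstFailureAbove (suc K) a with P? a
  ... | no ¬pa = a , λ c a≤c _ → inj₂ (¬pa , ≤-refl , a≤c)
  ... | yes pa with firstFailureAbove K (suc a)
  ...   | z , above = z , extend
    where
    extend : ∀ c → a ≤ c → c < a + suc K →
      (∀ b → a ≤ b → b ≤ c → P b) ⊎ (¬ P z × a ≤ z × z ≤ c)
    extend c a≤c c<a+K with m≤n⇒m<n∨m≡n a≤c
    ... | inj₂ refl = inj₁ λ b a≤b b≤a → subst P (≤-antisym a≤b b≤a) pa
    ... | inj₁ a<c with above c a<c (subst (c <_) (+-suc a K) c<a+K)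
    ...   | inj₂ (¬pz , a<z , z≤c) = inj₂ (¬pz , ≤-trans (n≤1+n a) a<z , z≤c)
    ...   | inj₁ clear = inj₁ λ b a≤b b≤c →
            [ (λ a<b → clear b a<b b≤c) , (λ a≡b → subst P a≡b pa) ]′ (m≤n⇒m<n∨m≡n a≤b)

  -- Downwards the search ends by itself at 0. If it meets no failure, 0 is returned as a
  -- placeholder and only the first alternative is ever claimed.
  firstFailureBelow : ∀ a → ∃ λ z → ∀ c → c ≤ a →
    (∀ b → c ≤ b → b ≤ a → P b) ⊎ (¬ P z × c ≤ z × z ≤ a)
  firstFailureBelow a with P? a
  firstFailureBelow a       | no ¬pa = a , λ c c≤a → inj₂ (¬pa , c≤a , ≤-refl)
  firstFailureBelow zero    | yes p0 = zero , λ { c z≤n → inj₁ λ { b _ z≤n → p0 } }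
  firstFailureBelow (suc a) | yes pa with firstFailureBelow a
  ... | z , below = z , extend
    where
    extend : ∀ c → c ≤ suc a → (∀ b → c ≤ b → b ≤ suc a → P b) ⊎ (¬ P z × c ≤ z × z ≤ suc a)
    extend c c≤1+a with m≤n⇒m<n∨m≡n c≤1+a
    ... | inj₂ refl = inj₁ λ b a≤b b≤a → subst P (≤-antisym a≤b b≤a) pa
    ... | inj₁ (s≤s c≤a) with below c c≤a
    ...   | inj₂ (¬pz , c≤z , z≤a) = inj₂ (¬pz , c≤z , ≤-trans z≤a (n≤1+n a))
    ...   | inj₁ clear = inj₁ λ b c≤b b≤1+a →
            [ (λ { (s≤s b≤a) → clear b c≤b b≤a }) , (λ b≡1+a → subst P (sym b≡1+a) pa) ]′ (m≤n⇒m<n∨m≡n b≤1+a)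

  barrierAbove : ℕ → ℕ → ℕ
  barrierAbove m a = proj₁ (firstFailureAbove (suc m) a)

  barrierBelow : ℕ → ℕ
  barrierBelow a = proj₁ (firstFailureBelow a)

  -- Two indices that depend on `a` alone are enough to obstruct every target `c`, so guarding two
  -- bags per starting vertex suffices wherever the fire heads.
  clear-or-barrier : ∀ m a c → c ≤ m → Clear a c ⊎
    ∃ λ z → (z ≡ barrierAbove m a ⊎ z ≡ barrierBelow a) × ¬ P z × Between a z c
  clear-or-barrier m a c c≤m with ≤-total a c
  -- A search of length `suc m` from any `a` covers all indices up to `m`.
  ... | inj₁ a≤c with proj₂ (firstFailureAbove (suc m) a) c a≤c
                        (≤-trans (s≤s c≤m) (≤-trans (m≤m+n (suc m) a) (≤-reflexive (+-comm (suc m) a))))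
  ...   | inj₂ (¬pz , a≤z , z≤c) = inj₂ (_ , inj₁ refl , ¬pz , inj₁ (a≤z , z≤c))
  ...   | inj₁ clear = inj₁ λ where
            b (inj₁ (a≤b , b≤c)) → clear b a≤b b≤c
            -- The opposite orientation is possible only if `a`, `b` and `c` coincide.
            b (inj₂ (c≤b , b≤a)) → clear b (≤-trans a≤c c≤b) (≤-trans b≤a a≤c)
  clear-or-barrier m a c c≤m | inj₂ c≤a with proj₂ (firstFailureBelow a) c c≤a
  ...   | inj₂ (¬pz , c≤z , z≤a) = inj₂ (_ , inj₂ refl , ¬pz , inj₂ (c≤z , z≤a))
  ...   | inj₁ clear = inj₁ λ where
            b (inj₁ (a≤b , b≤c)) → clear b (≤-trans c≤a a≤b) (≤-trans b≤c c≤a)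
            b (inj₂ (c≤b , b≤a)) → clear b c≤b b≤a

-- Selecting at most one vertex outside a given set

firstOutside : Subset k → List (Fin k) → Subset k
firstOutside S []       = ⊥
firstOutside S (x ∷ xs) with x ∈? S
... | yes _ = firstOutside S xs
... | no  _ = ⁅ x ⁆

∣firstOutside∣≤1 : (S : Subset k) → ∀ xs → ∣ firstOutside S xs ∣ ≤ 1
∣firstOutside∣≤1 {k} S [] = subst (_≤ 1) (sym (∣⊥∣≡0 k)) z≤n
∣firstOutside∣≤1 S (x ∷ xs) with x ∈? S
... | yes _ = ∣firstOutside∣≤1 S xs
... | no  _ = ≤-reflexive (∣⁅x⁆∣≡1 x)

firstOutside-∉ : (S : Subset k) → ∀ xs {v} → v ∈ firstOutside S xs → v ∉ S
firstOutside-∉ S [] v∈ = ⊥-elim (∉⊥ v∈)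
firstOutside-∉ S (x ∷ xs) v∈ with x ∈? S
... | yes _   = firstOutside-∉ S xs v∈
... | no  x∉S = subst (_∉ S) (sym (x∈⁅y⁆⇒x≡y x v∈)) x∉S

firstOutside-head : (S : Subset k) → ∀ x xs → x ∉ S → x ∈ firstOutside S (x ∷ xs)
firstOutside-head S x xs x∉S with x ∈? S
... | yes x∈S = contradiction x∈S x∉S
... | no  _   = x∈⁅x⁆ x

-- For a list containing every vertex, the second alternative says that all vertices are burned or
-- protected, which is when `ValidStrategy` permits a step without a new protection.
firstOutside-nonempty : (S : Subset k) → ∀ xs → (∃ λ v → v ∈ firstOutside S xs) ⊎ (∀ {v} → v ∈ₗ xs → v ∈ S)
firstOutside-nonempty S [] = inj₂ λ ()
firstOutside-nonempty S (x ∷ xs) with x ∈? S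
... | no  _   = inj₁ (x , x∈⁅x⁆ x)
... | yes x∈S with firstOutside-nonempty S xs
...   | inj₁ found = inj₁ found
...   | inj₂ all   = inj₂ λ { (here refl) → x∈S ; (there v∈) → all v∈ }

-- Balls about the fire and deadlines for protection

module Fire (G : Graph) (F : Subset (n G)) where

  Vertex : Set
  Vertex = Fin (n G)

  open import Data.List.Membership.DecPropositional (_≟_ {n G}) using () renaming (_∈?_ to _∈ₗ?_)

  neighbours : Vertex → List Vertex
  neighbours u = elements (tabulate (adj G u))

  ∈-neighbours : ∀ {u v} → Adj G u v → v ∈ₗ neighbours u
  ∈-neighbours {u} {v} uv = ∈-elements⁺ {p = tabulate (adj G u)} (lookup⇒[]= v _ (trans (lookup∘tabulate (adj G u) v) uv))

  -- Vertices may repeat in this list; its length bounds the size of the ball from above and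
  -- satisfies a simple recursion.
  ball : ℕ → List Vertex
  ball zero    = elements F
  ball (suc r) = ball r ++ concatMap neighbours (ball r)

  ball-step : ∀ {r u v} → u ∈ₗ ball r → Adj G u v → v ∈ₗ ball (suc r)
  ball-step {r} u∈ uv = ∈-++⁺ʳ (ball r) (∈-concatMap⁺ neighbours (Any.map (λ { refl → ∈-neighbours uv }) u∈))

  ball-mono : ∀ {r q} → r ≤ q → ∀ {v} → v ∈ₗ ball r → v ∈ₗ ball q
  ball-mono = go ∘ ≤⇒≤′
    where
    go : ∀ {r q} → r ≤′ q → ∀ {v} → v ∈ₗ ball r → v ∈ₗ ball q
    go ≤′-refl       v∈ = v∈
    go (≤′-step r≤q) v∈ = ∈-++⁺ˡ (go r≤q v∈)

  ∈-spread : ∀ {B v} → v ∈ spread G B → ∃ λ u → u ∈ B × Adj G u v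
  ∈-spread {B} {v} v∈
    with Any.satisfied (any⁻ (λ u → adj G u v ∧ V.lookup B u) (allFin (n G))
           (Equivalence.from T-≡ (trans (sym (lookup∘tabulate _ v)) ([]=⇒lookup v∈))))
  ... | u , both with adj G u v in uv | V.lookup B u in u∈B | both
  ...   | true | true | _ = u , lookup⇒[]= u B u∈B , uv

  module _ (P : Strategy G) where

    ∈-burned-suc : ∀ t {v} → v ∈ burned G F P (suc t) → v ∈ burned G F P t ⊎
      (v ∉ protected G P (suc t) × ∃ λ u → u ∈ burned G F P t × Adj G u v)
    ∈-burned-suc t v∈ with x∈p∪q⁻ (burned G F P t) _ v∈
    ... | inj₁ old = inj₁ old
    ... | inj₂ new with x∈p∩q⁻ (spread G (burned G F P t)) _ new
    ...   | v∈spread , v∉prot = inj₂ (x∈∁p⇒x∉p v∉prot , ∈-spread v∈spread)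

    -- Fire moves at most one edge per step whatever is protected, so balls give deadlines that can
    -- be fixed before the strategy is.
    burned⊆ball : ∀ t {v} → v ∈ burned G F P t → v ∈ₗ ball t
    burned⊆ball zero    v∈ = ∈-elements⁺ v∈
    burned⊆ball (suc t) v∈ with ∈-burned-suc t v∈
    ... | inj₁ old                = ∈-++⁺ˡ (burned⊆ball t old)
    ... | inj₂ (_ , u , u∈ , uv) = ball-step {t} (burned⊆ball t u∈) uv

    protected-disjoint-burned : (∀ t → Empty (P t ∩ burned G F P t)) →
      ∀ t {v} → v ∈ protected G P t → v ∉ burned G F P t
    protected-disjoint-burned valid zero    v∈prot _ = ∉⊥ v∈prot
    protected-disjoint-burned valid (suc t) v∈prot v∈burned with ∈-burned-suc t v∈burned
    ... | inj₂ (v∉prot , _) = v∉prot v∈prot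
    ... | inj₁ old with x∈p∪q⁻ (protected G P t) _ v∈prot
    ...   | inj₁ before = protected-disjoint-burned valid t before old
    ...   | inj₂ now    = valid t (_ , x∈p∩q⁺ (now , old))

  -- Protecting the list one vertex per step from time t on, no vertex is reached before its turn.
  data Timely : ℕ → List Vertex → Set where
    []  : ∀ {t} → Timely t []
    _∷_ : ∀ {t x xs} → x ∉ₗ ball t → Timely (suc t) xs → Timely t (x ∷ xs)

  -- The turns of `xs` are over by time `e`, so each entry, being outside `ball e`, is outside the
  -- smaller ball of its own turn. The condition on `ys` ranges over all `q ≤ e` because `xs` may be
  -- finished early.
  Timely-++ : ∀ {t e} xs {ys} → All (_∉ₗ ball e) xs → t + length xs ≤ e →
              (∀ {q} → q ≤ e → Timely q ys) → Timely t (xs ++ ys)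
  Timely-++ {t} [] _ t≤e ys = ys (subst (_≤ _) (+-identityʳ t) t≤e)
  Timely-++ {t} {e} (x ∷ xs) (x∉ ∷ xs∉) t+≤e ys =
    (λ x∈ → x∉ (ball-mono (≤-trans (m≤m+n t _) t+≤e) x∈)) ∷
    Timely-++ xs xs∉ (subst (_≤ e) (+-suc t (length xs)) t+≤e) ys

  Timely-∉-ball : ∀ {t xs v} → Timely t xs → v ∈ₗ xs → v ∉ₗ ball t
  Timely-∉-ball (x∉ ∷ _)  (here refl)     = x∉
  Timely-∉-ball (_ ∷ xs) (there v∈) v∈ball = Timely-∉-ball xs v∈ (∈-++⁺ˡ v∈ball)

  -- The greedy strategy that follows a schedule

  module Greedy (L : List Vertex) (timely : Timely 0 L) where

    -- The target scheduled for step `t` comes first. Later targets and then all vertices serve as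
    -- fallbacks, so that progress stops only when nothing is left to protect.
    choose : ℕ → Subset (n G) → Subset (n G) → Subset (n G)
    choose t B Q = firstOutside (B ∪ Q) (drop t L ++ allFin (n G))

    -- The choice at a step depends on the burned set, which depends on earlier choices. Computing
    -- burned and protected sets together breaks this circularity; `state≡` identifies them with the
    -- actual process.
    state : ℕ → Subset (n G) × Subset (n G)
    state zero    = F , ⊥
    state (suc t) = let B , Q = state t ; Q′ = Q ∪ choose t B Q in B ∪ (spread G B ∩ ∁ Q′) , Q′

    strategy : Strategy G
    strategy t = choose t (proj₁ (state t)) (proj₂ (state t))

    state≡ : ∀ t → state t ≡ (burned G F strategy t , protected G strategy t)
    state≡ zero    = refl
    state≡ (suc t) = cong₂ (λ B Q → B ∪ (spread G B ∩ ∁ (Q ∪ strategy t)) , Q ∪ strategy t)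
      (cong proj₁ (state≡ t)) (cong proj₂ (state≡ t))

    Bt Qt : ℕ → Subset (n G)
    Bt = burned G F strategy
    Qt = protected G strategy

    strategy≡ : ∀ t → strategy t ≡ choose t (Bt t) (Qt t)
    strategy≡ t = cong₂ (choose t) (cong proj₁ (state≡ t)) (cong proj₂ (state≡ t))

    strategy-∉ : ∀ t {v} → v ∈ strategy t → v ∉ Bt t ∪ Qt t
    strategy-∉ t v∈ = firstOutside-∉ (Bt t ∪ Qt t) (drop t L ++ allFin (n G)) (subst (_ ∈_) (strategy≡ t) v∈)

    strategy-unburned : ∀ t → Empty (strategy t ∩ Bt t)
    strategy-unburned t (v , v∈) with x∈p∩q⁻ (strategy t) _ v∈
    ... | v∈S , v∈B = strategy-∉ t v∈S (x∈p∪q⁺ (inj₁ v∈B))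

    strategy-valid : ∀ {b} → 1 ≤ b → ValidStrategy G F b strategy
    strategy-valid 1≤b t =
      ≤-trans (∣firstOutside∣≤1 _ (drop t L ++ allFin (n G))) 1≤b , strategy-unburned t , progress
      where
      progress : 1 ≤ ∣ strategy t ∩ ∁ (Qt t) ∣ ⊎ Empty (∁ (Bt t ∪ Qt t))
      progress with firstOutside-nonempty (Bt t ∪ Qt t) (drop t L ++ allFin (n G))
      ... | inj₂ all = inj₂ λ (v , v∈) → x∈∁p⇒x∉p v∈ (all (∈-++⁺ʳ (drop t L) (∈-allFin v)))
      ... | inj₁ (v , v∈) = inj₁ (∈⇒∣p∣>0
        (x∈p∩q⁺ (v∈S , x∉p⇒x∈∁p λ v∈Q → strategy-∉ t v∈S (x∈p∪q⁺ (inj₂ v∈Q)))))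
        where
        v∈S : v ∈ strategy t
        v∈S = subst (v ∈_) (sym (strategy≡ t)) v∈

    drop-timely : ∀ t → Timely t (drop t L)
    drop-timely t = subst (λ q → Timely q (drop t L)) (+-identityʳ t) (go t timely)
      where
      go : ∀ t {q xs} → Timely q xs → Timely (t + q) (drop t xs)
      go zero    xs         = xs
      go (suc t) []         = []
      go (suc t) {q} {_ ∷ xs} (_ ∷ timely) = subst (λ r → Timely r (drop t xs)) (+-suc t q) (go t timely)

    -- The only entry leaving the pending list at step `t` is its head. If still unprotected, it is
    -- also unburned, since the fire lies in `ball t`, and the greedy rule selects it.
    protected-or-pending : ∀ {v} → v ∈ₗ L → ∀ t → v ∈ Qt t ⊎ v ∈ₗ drop t L
    protected-or-pending v∈L zero = inj₂ v∈L
    protected-or-pending {v} v∈L (suc t) with protected-or-pending v∈L t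
    ... | inj₁ v∈Q = inj₁ (x∈p∪q⁺ (inj₁ v∈Q))
    ... | inj₂ v∈drop = advance (drop t L) refl v∈drop (drop-timely t)
      where
      advance : ∀ xs → drop t L ≡ xs → v ∈ₗ xs → Timely t xs → v ∈ Qt (suc t) ⊎ v ∈ₗ drop (suc t) L
      advance (x ∷ xs) eq (there v∈xs) _ = inj₂ (subst (v ∈ₗ_) (sym (drop-suc t L eq)) v∈xs)
        where
        drop-suc : ∀ t ys → drop t ys ≡ x ∷ xs → drop (suc t) ys ≡ xs
        drop-suc zero    (_ ∷ _)  refl = refl
        drop-suc (suc t) (_ ∷ ys) eq   = drop-suc t ys eq
      -- The head may have been protected before, through a repetition in `L` or as a fallback.
      advance (x ∷ xs) eq (here refl) (x∉ball ∷ _) with v ∈? Qt t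
      ... | yes v∈Q = inj₁ (x∈p∪q⁺ (inj₁ v∈Q))
      ... | no  v∉Q = inj₁ (x∈p∪q⁺ (inj₂
        (subst (v ∈_) (sym chosen) (firstOutside-head (Bt t ∪ Qt t) v _ v∉))))
        where
        v∉ : v ∉ Bt t ∪ Qt t
        v∉ v∈ = [ x∉ball ∘ burned⊆ball strategy t , v∉Q ]′ (x∈p∪q⁻ (Bt t) _ v∈)
        chosen : strategy t ≡ firstOutside (Bt t ∪ Qt t) ((v ∷ xs) ++ allFin (n G))
        chosen = trans (strategy≡ t) (cong (λ ys → firstOutside (Bt t ∪ Qt t) (ys ++ allFin (n G))) eq)

    -- A protected target cannot burn, and a pending one is outside the ball that contains the fire.
    burned-avoids : ∀ {v} → v ∈ₗ L → ∀ t → v ∉ Bt t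
    burned-avoids v∈L t v∈B with protected-or-pending v∈L t
    ... | inj₁ v∈Q    = protected-disjoint-burned strategy strategy-unburned t v∈Q v∈B
    ... | inj₂ v∈drop = Timely-∉-ball (drop-timely t) v∈drop (burned⊆ball strategy t v∈B)

  -- Annuli and barriers in the path decomposition

  module Barriers {s : ℕ} (decomposition : PathDecomposition G s) (D : ℕ → ℕ) where
    open PathDecomposition decomposition

    -- The index is clamped at m, so contiguity holds on all of ℕ.
    clamp : ℕ → Fin (suc m)
    clamp i = fromℕ< (s≤s (m⊓n≤m m i))

    toℕ-clamp : ∀ i → toℕ (clamp i) ≡ m ⊓ i
    toℕ-clamp i = toℕ-fromℕ< (s≤s (m⊓n≤m m i))

    clamp-mono : ∀ {i j} → i ≤ j → toℕ (clamp i) ≤ toℕ (clamp j)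
    clamp-mono {i} {j} i≤j rewrite toℕ-clamp i | toℕ-clamp j = ⊓-monoʳ-≤ m i≤j

    clamp-toℕ : ∀ i → clamp (toℕ i) ≡ i
    clamp-toℕ i = toℕ-injective (trans (toℕ-clamp (toℕ i)) (m≥n⇒m⊓n≡n (toℕ≤pred[n] i)))

    X : ℕ → List Vertex
    X i = elements (bag (clamp i))

    length-X : ∀ i → length (X i) ≤ s
    length-X i = subst (_≤ s) (sym (length-elements (bag (clamp i)))) (bagSize (clamp i))

    ∈-X : ∀ {v i} → v ∈ bag i → v ∈ₗ X (toℕ i)
    ∈-X {v} {i} v∈ = ∈-elements⁺ (subst (λ j → v ∈ bag j) (sym (clamp-toℕ i)) v∈)

    X-convex : ∀ {v i j k} → Between i j k → v ∈ₗ X i → v ∈ₗ X k → v ∈ₗ X j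
    X-convex (inj₁ (i≤j , j≤k)) v∈i v∈k = ∈-elements⁺
      (contiguous _ _ _ _ (clamp-mono i≤j) (clamp-mono j≤k) (∈-elements⁻ v∈i) (∈-elements⁻ v∈k))
    X-convex (inj₂ (k≤j , j≤i)) v∈i v∈k = ∈-elements⁺
      (contiguous _ _ _ _ (clamp-mono k≤j) (clamp-mono j≤i) (∈-elements⁻ v∈k) (∈-elements⁻ v∈i))

    home : Vertex → ℕ
    home v = toℕ (proj₁ (covVertex v))

    ∈-home : ∀ v → v ∈ₗ X (home v)
    ∈-home v = ∈-X (proj₂ (covVertex v))

    home≤m : ∀ v → home v ≤ m
    home≤m v = toℕ≤pred[n] (proj₁ (covVertex v))

    Annulus : ℕ → Vertex → Set
    Annulus j v = v ∈ₗ ball (D (suc j)) × v ∉ₗ ball (D j)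

    Meets : ℕ → ℕ → Set
    Meets j i = Any (Annulus j) (X i)

    meets? : ∀ j → Decidable (Meets j)
    meets? j i = any? (λ v → (v ∈ₗ? ball (D (suc j))) ×-dec ¬? (v ∈ₗ? ball (D j))) (X i)

    outside : ℕ → List Vertex → List Vertex
    outside r = filter (λ v → ¬? (v ∈ₗ? ball r))

    gates : ℕ → Vertex → List Vertex
    gates j u = X (barrierAbove (meets? j) m (home u)) ++ X (barrierBelow (meets? j) (home u))

    -- A fire leaving `ball (D j)` first appears in `ball (suc (D j))`, so gates are built from
    -- there. The filter keeps the vertices that the fire cannot reach by time `D (suc j)`.
    level : ℕ → List Vertex
    level j = outside (D (suc j)) (concatMap (gates j) (ball (suc (D j))))

    length-level : ∀ j → length (level j) ≤ length (ball (suc (D j))) * (s + s)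
    length-level j = ≤-trans (length-filter _ (concatMap (gates j) (ball (suc (D j)))))
      (length-concatMap-≤ (gates j) length-gates (ball (suc (D j))))
      where
      length-gates : ∀ u → length (gates j u) ≤ s + s
      length-gates u = subst (_≤ s + s) (sym (length-++ (X (barrierAbove (meets? j) m (home u)))))
        (+-mono-≤ (length-X _) (length-X _))

    -- As the bag misses the annulus and `v` is outside the inner ball, `v` is outside the outer
    -- ball too and passes the filter.
    barrier⊆level : ∀ {j u v z} → u ∈ₗ ball (suc (D j)) → v ∉ₗ ball (D j) → v ∈ₗ X z → ¬ Meets j z →
      z ≡ barrierAbove (meets? j) m (home u) ⊎ z ≡ barrierBelow (meets? j) (home u) → v ∈ₗ level j
    barrier⊆level {j} {u} {v} u∈ v∉ v∈z ¬meets z≡ =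
      ∈-filter⁺ _ (∈-concatMap⁺ (gates j) (Any.map (λ { refl → in-gate z≡ }) u∈))
        λ v∈ → ¬meets (Any.map (λ { refl → v∈ , v∉ }) v∈z)
      where
      in-gate : _ → v ∈ₗ gates j u
      in-gate (inj₁ refl) = ∈-++⁺ˡ v∈z
      in-gate (inj₂ refl) = ∈-++⁺ʳ (X (barrierAbove (meets? j) m (home u))) v∈z

    levels : ℕ → ℕ → List Vertex
    levels j zero    = []
    levels j (suc c) = level j ++ levels (suc j) c

    ∈-levels : ∀ {j c} i → i < c → ∀ {v} → v ∈ₗ level (i + j) → v ∈ₗ levels j c
    ∈-levels {j} zero    (s≤s _)   v∈ = ∈-++⁺ˡ v∈
    ∈-levels {j} (suc i) (s≤s i<c) {v} v∈ =
      ∈-++⁺ʳ (level j) (∈-levels i i<c (subst (λ q → v ∈ₗ level q) (sym (+-suc i j)) v∈))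

    module _ (room : ∀ j → D j + length (level j) ≤ D (suc j)) where

      -- Level `j` begins by time `D j`, and `room` lets it end by `D (suc j)`, before the fire can
      -- reach its vertices. The next level then begins on time.
      levels-timely : ∀ j c {t} → t ≤ D j → Timely t (levels j c)
      levels-timely j zero    t≤ = []
      levels-timely j (suc c) t≤ = Timely-++ (level j)
        (All.tabulate λ v∈ → proj₂ (∈-filter⁻ _ {xs = concatMap (gates j) (ball (suc (D j)))} v∈))
        (≤-trans (+-mono-≤ t≤ ≤-refl) (room j)) (levels-timely (suc j) c)

      D-mono : ∀ {i j} → i ≤ j → D i ≤ D j
      D-mono = go ∘ ≤⇒≤′
        where
        go : ∀ {i j} → i ≤′ j → D i ≤ D j
        go ≤′-refl       = ≤-refl
        go (≤′-step i≤j) = ≤-trans (go i≤j) (≤-trans (m≤m+n _ _) (room _))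

      module _ (P : Strategy G) (avoids : ∀ {v} → v ∈ₗ levels 0 s → ∀ t → v ∉ burned G F P t) where

        -- A fire outside ball (D j) in bag i came through some u of ball (suc (D j)), and since then
        -- has not crossed a bag missing the annulus.
        Trail : ℕ → ℕ → Set
        Trail j i = ∃ λ u → u ∈ₗ ball (suc (D j)) × Clear (meets? j) (home u) i

        -- Otherwise a barrier bag `z` lies between `home u` and `i`. It contains `v`: by convexity
        -- if it lies between `e` and `i`, and by `before` if it lies between `home u` and `e`, as
        -- it misses the annulus. So `v` was scheduled and cannot burn.
        extend-trail : ∀ {j t u v e i} → j < s → v ∈ burned G F P t → v ∉ₗ ball (D j) →
          u ∈ₗ ball (suc (D j)) → v ∈ₗ X e → v ∈ₗ X i → i ≤ m →
          (∀ b → Between (home u) b e → Meets j b ⊎ v ∈ₗ X b) → Clear (meets? j) (home u) i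
        extend-trail {j} {t} {u} {v} {e} {i} j<s burning v∉ u∈ v∈e v∈i i≤m before
          with clear-or-barrier (meets? j) m (home u) i i≤m
        ... | inj₁ clear = clear
        ... | inj₂ (z , z≡ , ¬meets , between) = contradiction burning (avoids (∈-levels j j<s v∈level) t)
          where
          v∈z : v ∈ₗ X z
          v∈z with between-split between e
          ... | inj₂ e-z-i = X-convex e-z-i v∈e v∈i
          ... | inj₁ u-z-e with before z u-z-e
          ...   | inj₁ meets = contradiction meets ¬meets
          ...   | inj₂ v∈z   = v∈z
          v∈level : v ∈ₗ level (j + 0)
          v∈level = subst (λ q → v ∈ₗ level q) (sym (+-identityʳ j)) (barrier⊆level u∈ v∉ v∈z ¬meets z≡)

        -- Induction on time, through the neighbour `w` that ignites `v`. If `w` is in `ball (D j)`,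
        -- a trail starts at `v` itself; if not, the trail of `w` reaches a bag shared by `w` and
        -- `v` and is extended from there.
        burned-trail : ∀ {j} → j < s → ∀ t {v} → v ∈ burned G F P t → v ∉ₗ ball (D j) →
          ∀ {i} → i ≤ m → v ∈ₗ X i → Trail j i
        burned-trail {j} j<s zero v∈F v∉ = contradiction (ball-mono {q = D j} z≤n (∈-elements⁺ v∈F)) v∉
        burned-trail {j} j<s (suc t) {v} burning v∉ {i} i≤m v∈i with ∈-burned-suc P t burning
        ... | inj₁ old = burned-trail j<s t old v∉ i≤m v∈i
        ... | inj₂ (_ , w , w-burned , wv) with w ∈ₗ? ball (D j)
        ...   | yes w∈ = v , v∈ , extend-trail {t = suc t} j<s burning v∉ v∈ (∈-home v) v∈i i≤m
                  λ b between → inj₂ (subst (λ q → v ∈ₗ X q) (sym (between-refl between)) (∈-home v))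
          where
          v∈ : v ∈ₗ ball (suc (D j))
          v∈ = ball-step {D j} w∈ wv
        ...   | no w∉ with covEdge w v wv
        ...     | e , w∈e , v∈e with burned-trail j<s t w-burned w∉ (toℕ≤pred[n] e) (∈-X w∈e)
        ...       | u , u∈ , clear = u , u∈ , extend-trail {t = suc t} j<s burning v∉ u∈ (∈-X v∈e) v∈i i≤m
                      λ b → inj₁ ∘ clear b

        burned⊆ball-D : ∀ t {v} → v ∈ burned G F P t → v ∈ₗ ball (D s)
        burned⊆ball-D t {v} burning with v ∈ₗ? ball (D s)
        ... | yes v∈ = v∈
        ... | no  v∉ = contradiction (≤-trans (unique⇒length≤ unique inX) (length-X i))
          (<⇒≱ (s≤s (≤-reflexive (sym len))))
          where
          i : ℕ
          i = home v
          meets : ∀ j → j < s → Meets j i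
          meets j j<s with burned-trail j<s t burning
            (v∉ ∘ ball-mono (D-mono (≤-trans (n≤1+n j) j<s))) (home≤m v) (∈-home v)
          ... | u , _ , clear with ≤-total (home u) i
          ...   | inj₁ u≤i = clear i (inj₁ (u≤i , ≤-refl))
          ...   | inj₂ i≤u = clear i (inj₂ (≤-refl , i≤u))
          -- Keeping all picks inside `ball (D c)` makes the next one new, since it comes from the
          -- annulus outside that ball.
          pick : ∀ c → c ≤ s → ∃ λ ys → Unique ys × length ys ≡ c ×
                 (∀ {y} → y ∈ₗ ys → y ∈ₗ X i × y ∈ₗ ball (D c))
          pick zero    _   = [] , [] , refl , λ ()
          pick (suc c) c<s with pick c (≤-trans (n≤1+n c) c<s) | find (meets c c<s)
          ... | ys , ys! , len , in-ys | y , y∈X , y∈ , y∉ =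
            y ∷ ys , All.tabulate (λ { x∈ refl → y∉ (proj₂ (in-ys x∈)) }) ∷ ys! , cong suc len , λ where
              (here refl) → y∈X , y∈
              (there x∈)  → proj₁ (in-ys x∈) , ball-mono (D-mono (n≤1+n c)) (proj₂ (in-ys x∈))
          picked = pick s ≤-refl
          len : length (proj₁ picked) ≡ s
          len = proj₁ (proj₂ (proj₂ picked))
          unique : Unique (v ∷ proj₁ picked)
          unique = All.tabulate (λ { x∈ refl → v∉ (proj₂ (proj₂ (proj₂ (proj₂ picked)) x∈)) }) ∷ proj₁ (proj₂ picked)
          inX : ∀ {x} → x ∈ₗ v ∷ proj₁ picked → x ∈ₗ X i
          inX (here refl) = ∈-home v
          inX (there x∈)  = proj₁ (proj₂ (proj₂ (proj₂ picked)) x∈)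

-- Numerical bounds and assembly of the theorem

ballBound : ℕ → ℕ → ℕ → ℕ
ballBound f Δ zero    = f
ballBound f Δ (suc r) = ballBound f Δ r + ballBound f Δ r * Δ

f≤ballBound : ∀ f Δ r → f ≤ ballBound f Δ r
f≤ballBound f Δ zero    = ≤-refl
f≤ballBound f Δ (suc r) = ≤-trans (f≤ballBound f Δ r) (m≤m+n _ _)

-- The increment bounds the size of a level: each vertex of the ball of radius one more contributes
-- two bags of at most `s` vertices, and one vertex is protected per step.
radius : (f Δ s : ℕ) → ℕ → ℕ
radius f Δ s zero    = 0
radius f Δ s (suc j) = radius f Δ s j + ballBound f Δ (suc (radius f Δ s j)) * (s + s)

theorem2 : (f₁ : ℕ → ℕ → ℕ) →
    ∃ λ (f₂ : ℕ → ℕ → ℕ) →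
    (∀ p d → f₁ p d ≤ f₂ p d) ×
    (∀ (G : Graph) (pw Δ : ℕ) → Pathwidth G pw → MaxDegree G Δ →
    ∀ (F : Subset (n G)) → ∣ F ∣ ≤ f₁ pw Δ →
    ∀ (b : ℕ) → 1 ≤ b →
    ∃ λ (P : Strategy G) → ValidStrategy G F b P ×
    (∀ t → ∣ burned G F P t ∣ ≤ f₂ pw Δ))
-- Bags have at most `suc p` vertices, so `suc p` annuli suffice; the value bounds the ball that
-- encloses the last of them.
theorem2 f₁ = (λ p d → ballBound (f₁ p d) d (radius (f₁ p d) d (suc p) (suc p))) ,
  (λ p d → f≤ballBound (f₁ p d) d (radius (f₁ p d) d (suc p) (suc p))) , strategyFor
  where
  strategyFor : ∀ (G : Graph) (pw Δ : ℕ) → Pathwidth G pw → MaxDegree G Δ →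
    ∀ (F : Subset (n G)) → ∣ F ∣ ≤ f₁ pw Δ → ∀ (b : ℕ) → 1 ≤ b →
    ∃ λ (P : Strategy G) → ValidStrategy G F b P ×
    (∀ t → ∣ burned G F P t ∣ ≤ ballBound (f₁ pw Δ) Δ (radius (f₁ pw Δ) Δ (suc pw) (suc pw)))
  strategyFor G pw Δ (decomposition , _) (degree≤Δ , _) F ∣F∣≤f b 1≤b =
    strategy , strategy-valid 1≤b , λ t →
      ≤-trans (⊆⇒∣p∣≤length _ _ (burned⊆ball-D room strategy burned-avoids t)) (length-ball (D (suc pw)))
    where
    D : ℕ → ℕ
    D = radius (f₁ pw Δ) Δ (suc pw)
    open Fire G F
    open Barriers decomposition D
    length-ball : ∀ r → length (ball r) ≤ ballBound (f₁ pw Δ) Δ r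
    length-ball zero    = subst (_≤ f₁ pw Δ) (sym (length-elements F)) ∣F∣≤f
    length-ball (suc r) = subst (_≤ ballBound (f₁ pw Δ) Δ (suc r)) (sym (length-++ (ball r)))
      (+-mono-≤ (length-ball r) (≤-trans
        (length-concatMap-≤ neighbours
          (λ u → subst (_≤ Δ) (sym (length-elements (tabulate (adj G u)))) (degree≤Δ u)) (ball r))
        (*-monoˡ-≤ Δ (length-ball r))))
    room : ∀ j → D j + length (level j) ≤ D (suc j)
    room j = +-monoʳ-≤ (D j) (≤-trans (length-level j) (*-monoˡ-≤ (suc pw + suc pw) (length-ball (suc (D j)))))
    open Greedy (levels 0 (suc pw)) (levels-timely room 0 (suc pw) z≤n)
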